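{- Let $f(n)$ be the largest integer such that every poset on $n$ elements has a subposet on $f(n)$ elements of dimension at most $2$. Then \[ f(n) \leq 4n^{2/3} + o\left(n^{2/3}\right) \quad (n\to\infty). \]
   Context: A subposet of a poset $P$ is a subset of its ground set with the order induced from $P$. The dimension $\dim(P)$ of a poset $P$ is the least integer $d$ such that there are $d$ linear extensions of $P$ whose intersection is $P$ (equivalently, the least $d$ such that $P$ embeds into $\mathbb{R}^d$ with the product order, i.e. $x<y$ in $P$ iff the image of $x$ is coordinatewise below the image of $y$). -}

module Defs where

open import Level using (Level; 0ℓ; _⊔_; suc)
open import Data.Empty using (⊥-elim)
open import Data.Fin.Base using (Fin; combine; remQuot)
open import Data.Fin.Properties using (all?; remQuot-combine)
  renaming (_≟_ to _≟ᶠ_)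
open import Data.Fin.Subset as Subset using (Subset; _∈_; ∣_∣)
open import Data.Fin.Subset.Properties using (_∈?_; anySubset?; ∣p∣≤n; ∣⊥∣≡0; ∉⊥)
open import Data.Nat.Base as ℕ using (ℕ; zero; z≤n; NonZero)
import Data.Nat.Properties as ℕₚ
open import Data.Product using (Σ; Σ-syntax; ∃; ∃-syntax; _×_; _,_; proj₁; proj₂)
open import Data.Sum.Base using (_⊎_; inj₁; inj₂)
import Data.Sum.Base as Sum
open import Data.Vec.Base using (tabulate)
open import Data.Vec.Properties using (lookup⇒[]=; []=⇒lookup; lookup∘tabulate)
open import Data.Vec.Properties.WithK using ([]=-irrelevant)
open import Function.Base using (_∘_; id)
open import Function.Bundles using (_⇔_; mk⇔; Equivalence)
open import Relation.Binary.Bundles using (Poset)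
open import Relation.Binary.Consequences using (total∧dec⇒dec)
import Relation.Binary.Construct.On as On
open import Relation.Binary.Core using (Rel; REL; _⇒_)
open import Relation.Binary.Definitions using (Decidable)
open import Relation.Binary.PropositionalEquality
  using (_≡_; refl; sym; trans; subst; isEquivalence)
open import Relation.Binary.Structures
  using (IsPartialOrder; IsTotalOrder; IsDecPartialOrder)
open import Relation.Nullary using (¬_; Dec; yes; no; does)
open import Relation.Nullary.Decidable
  using (map′; _×-dec_; _⊎-dec_; _→-dec_; ¬?; decidable-stable; dec-true)
open import Relation.Unary using (Pred)
import Relation.Unary as U

private
  variable
    a b ℓ : Level

IsLeast : Pred ℕ ℓ → ℕ → Set ℓ
IsLeast Q m = Q m × (∀ k → Q k → m ℕ.≤ k)

IsGreatest : Pred ℕ ℓ → ℕ → Set ℓ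
IsGreatest Q m = Q m × (∀ k → Q k → k ℕ.≤ m)

module _ {c ℓ₁ ℓ₂} (P : Poset c ℓ₁ ℓ₂) where
  open Poset P

  record IsLinearExtension (_⊑_ : Rel Carrier ℓ₂) : Set (c ⊔ ℓ₁ ⊔ ℓ₂) where
    field
      isTotalOrder : IsTotalOrder _≈_ _⊑_
      extends      : _≤_ ⇒ _⊑_

  HasRealizer : ℕ → Set (c ⊔ ℓ₁ ⊔ suc ℓ₂)
  HasRealizer d = Σ[ L ∈ (Fin d → Rel Carrier ℓ₂) ]
    (∀ i → IsLinearExtension (L i)) × (∀ x y → x ≤ y ⇔ (∀ i → L i x y))

  IsDimension : ℕ → Set (c ⊔ ℓ₁ ⊔ suc ℓ₂)
  IsDimension = IsLeast HasRealizer

  DimensionAtMost : ℕ → Set (c ⊔ ℓ₁ ⊔ suc ℓ₂)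
  DimensionAtMost k = ∃[ d ] IsDimension d × d ℕ.≤ k

-- The order is decidable, as it always is classically, so that the
-- finite search defining `f` below can be carried out.
record FinPoset (n : ℕ) : Set₁ where
  field
    _≤_               : Rel (Fin n) 0ℓ
    isDecPartialOrder : IsDecPartialOrder _≡_ _≤_

  open IsDecPartialOrder isDecPartialOrder public

  poset : Poset 0ℓ 0ℓ 0ℓ
  poset = record { isPartialOrder = isPartialOrder }

subposet : ∀ {n} → FinPoset n → Subset n → Poset 0ℓ 0ℓ 0ℓ
subposet P S = On.poset (FinPoset.poset P) (proj₁ {B = _∈ S})

EveryPosetHasSubposet : (n m : ℕ) → Set₁
EveryPosetHasSubposet n m = (P : FinPoset n) →
  Σ[ S ∈ Subset n ] ∣ S ∣ ≡ m × DimensionAtMost (subposet P S) 2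

private

  guarded? : {A : Set a} {B : A → Set b} → Dec A → (∀ x y → B x → B y) →
             (∀ x → Dec (B x)) → Dec (∀ x → B x)
  guarded? (no ¬x) _    _  = yes (λ x → ⊥-elim (¬x x))
  guarded? (yes x) resp B? = map′ (λ b y → resp x y b) (λ b → b x) (B? x)

  allSubsets? : ∀ {n} {Q : Pred (Subset n) ℓ} → U.Decidable Q → Dec (∀ S → Q S)
  allSubsets? Q? = map′
    (λ ¬∃ S → decidable-stable (Q? S) (λ ¬q → ¬∃ (S , ¬q)))
    (λ ∀Q (S , ¬q) → ¬q (∀Q S))
    (¬? (anySubset? (¬? ∘ Q?)))

  ⟨_⟩ : ∀ {n} {Q : Pred (Fin n) ℓ} → U.Decidable Q → Subset n
  ⟨ Q? ⟩ = tabulate (does ∘ Q?)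

  ∈⟨⟩⁺ : ∀ {n} {Q : Pred (Fin n) ℓ} (Q? : U.Decidable Q) {i} → Q i → i ∈ ⟨ Q? ⟩
  ∈⟨⟩⁺ Q? {i} q = lookup⇒[]= i _ (trans (lookup∘tabulate _ i) (dec-true (Q? i) q))

  ∈⟨⟩⁻ : ∀ {n} {Q : Pred (Fin n) ℓ} (Q? : U.Decidable Q) {i} → i ∈ ⟨ Q? ⟩ → Q i
  ∈⟨⟩⁻ Q? {i} i∈ with Q? i | trans (sym (lookup∘tabulate (does ∘ Q?) i)) ([]=⇒lookup i∈)
  ... | yes q | _ = q
  ... | no  _ | ()

  -- Relations as subsets of a product, so that anySubset? ranges over them.

  ⟦_⟧ : ∀ {m n} → Subset (m ℕ.* n) → REL (Fin m) (Fin n) 0ℓ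
  ⟦ M ⟧ x y = combine x y ∈ M

  module _ {m n} {R : REL (Fin m) (Fin n) ℓ} (R? : Decidable R) where

    Q : Fin m × Fin n → Set _
    Q (x , y) = R x y

    Q? : U.Decidable (Q ∘ remQuot {m} n)
    Q? k = R? (proj₁ (remQuot {m} n k)) (proj₂ (remQuot {m} n k))

    encode : Subset (m ℕ.* n)
    encode = ⟨ Q? ⟩

    encode⁺ : ∀ {x y} → R x y → ⟦ encode ⟧ x y
    encode⁺ {x} {y} r = ∈⟨⟩⁺ Q? (subst Q (sym (remQuot-combine x y)) r)

    encode⁻ : ∀ {x y} → ⟦ encode ⟧ x y → R x y
    encode⁻ {x} {y} m = subst Q (remQuot-combine x y) (∈⟨⟩⁻ Q? m)

  ⟦_⟧ᶠ : ∀ {d n} → Subset (d ℕ.* (n ℕ.* n)) → Fin d → Rel (Fin n) 0ℓ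
  ⟦ M ⟧ᶠ i x y = ⟦ M ⟧ i (combine x y)

  module _ {d n} {R : Fin d → Rel (Fin n) ℓ} (R? : ∀ i → Decidable (R i)) where

    member? : Decidable (λ i k → k ∈ encode (R? i))
    member? i k = k ∈? encode (R? i)

    encodeᶠ : Subset (d ℕ.* (n ℕ.* n))
    encodeᶠ = encode member?

    encodeᶠ⁺ : ∀ {i x y} → R i x y → ⟦ encodeᶠ ⟧ᶠ i x y
    encodeᶠ⁺ {i} r = encode⁺ member? (encode⁺ (R? i) r)

    encodeᶠ⁻ : ∀ {i x y} → ⟦ encodeᶠ ⟧ᶠ i x y → R i x y
    encodeᶠ⁻ {i} m = encode⁻ (R? i) (encode⁻ member? m)

  isPartialOrder? : ∀ {n} {_≤_ : Rel (Fin n) 0ℓ} → Decidable _≤_ →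
                    Dec (IsPartialOrder _≡_ _≤_)
  isPartialOrder? _≤?_ = map′
    (λ (r , t , s) → record
      { isPreorder = record
        { isEquivalence = isEquivalence
        ; reflexive     = λ { refl → r _ }
        ; trans         = λ p q → t _ _ _ p q
        }
      ; antisym = λ p q → s _ _ p q
      })
    (λ po → (λ _ → IsPartialOrder.refl po) , (λ _ _ _ → IsPartialOrder.trans po) ,
            (λ _ _ → IsPartialOrder.antisym po))
    (all? (λ x → x ≤? x)
      ×-dec all? (λ x → all? λ y → all? λ z → (x ≤? y) →-dec ((y ≤? z) →-dec (x ≤? z)))
      ×-dec all? (λ x → all? λ y → (x ≤? y) →-dec ((y ≤? x) →-dec (x ≟ᶠ y))))

  module _ {n} (P : FinPoset n) (S : Subset n) where
    private
      open FinPoset P using (_≤?_)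
      open Poset (subposet P S) using (Carrier; _≈_) renaming (_≤_ to _≼_)

    _≼?_ : Decidable _≼_
    (x , _) ≼? (y , _) = x ≤? y

    allCarrier? : {Q : Pred Carrier ℓ} → U.Decidable Q → Dec (∀ x → Q x)
    allCarrier? {Q = Q} Q? = map′ (λ q (x , p) → q x p) (λ q x p → q (x , p)) (all? atPoint)
      where
      atPoint : ∀ x → Dec ((p : x ∈ S) → Q (x , p))
      atPoint x = guarded? (x ∈? S)
        (λ p p′ → subst (λ p → Q (x , p)) ([]=-irrelevant p p′)) (λ p → Q? (x , p))

    isLinearExtension? : {_⊑_ : Rel Carrier 0ℓ} → Decidable _⊑_ →
                         Dec (IsLinearExtension (subposet P S) _⊑_)
    isLinearExtension? _⊑?_ = map′
      (λ (r , t , s , l , e) → record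
        { isTotalOrder = record
          { isPartialOrder = record
            { isPreorder = record
              { isEquivalence = Poset.isEquivalence (subposet P S)
              ; reflexive     = λ {x} {y} → r x y
              ; trans         = λ {x} {y} {z} → t x y z
              }
            ; antisym = λ {x} {y} → s x y
            }
          ; total = l
          }
        ; extends = λ {x} {y} → e x y
        })
      (λ le →
        (λ x y → T.reflexive le {x} {y}) , (λ x y z → T.trans le {x} {y} {z}) ,
        (λ x y → T.antisym le {x} {y}) , T.total le ,
        (λ x y → IsLinearExtension.extends le {x} {y}))
      (all² (λ x y → (proj₁ x ≟ᶠ proj₁ y) →-dec (x ⊑? y))
        ×-dec allCarrier? (λ x → all² λ y z → (x ⊑? y) →-dec ((y ⊑? z) →-dec (x ⊑? z)))
        ×-dec all² (λ x y → (x ⊑? y) →-dec ((y ⊑? x) →-dec (proj₁ x ≟ᶠ proj₁ y)))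
        ×-dec all² (λ x y → (x ⊑? y) ⊎-dec (y ⊑? x))
        ×-dec all² (λ x y → (x ≼? y) →-dec (x ⊑? y)))
      where
      module T {_⊑_} (le : IsLinearExtension (subposet P S) _⊑_) =
        IsTotalOrder (IsLinearExtension.isTotalOrder le)

      all² : {Q : Rel Carrier ℓ} → Decidable Q → Dec (∀ x y → Q x y)
      all² Q? = allCarrier? λ x → allCarrier? λ y → Q? x y

    IsRealizer : ∀ {d} → (Fin d → Rel Carrier 0ℓ) → Set
    IsRealizer L = (∀ i → IsLinearExtension (subposet P S) (L i))
                 × (∀ x y → x ≼ y ⇔ (∀ i → L i x y))

    isRealizer? : ∀ {d} {L : Fin d → Rel Carrier 0ℓ} → (∀ i → Decidable (L i)) →
                  Dec (IsRealizer L)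
    isRealizer? L? =
      all? (λ i → isLinearExtension? (L? i)) ×-dec
      allCarrier? (λ x → allCarrier? λ y →
        map′ (λ (f , g) → mk⇔ f g) (λ e → Equivalence.to e , Equivalence.from e)
          (((x ≼? y) →-dec all? (λ i → L? i x y)) ×-dec
           (all? (λ i → L? i x y) →-dec (x ≼? y))))

    isRealizer-resp : ∀ {d} {L L′ : Fin d → Rel Carrier 0ℓ} →
      (∀ {i} → L i ⇒ L′ i) → (∀ {i} → L′ i ⇒ L i) → IsRealizer L → IsRealizer L′
    isRealizer-resp to from (lin , int) =
      (λ i → record
        { isTotalOrder = record
          { isPartialOrder = record
            { isPreorder = record
              { isEquivalence = Poset.isEquivalence (subposet P S)
              ; reflexive     = λ {x} {y} e → to (T.reflexive i {x} {y} e)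
              ; trans         = λ p q → to (T.trans i (from p) (from q))
              }
            ; antisym = λ p q → T.antisym i (from p) (from q)
            }
          ; total = λ x y → Sum.map to to (T.total i x y)
          }
        ; extends = λ {x} {y} p → to (IsLinearExtension.extends (lin i) {x} {y} p)
        }) ,
      (λ x y → mk⇔ (λ p i → to (Equivalence.to (int x y) p i))
                   (λ p → Equivalence.from (int x y) (λ i → from (p i))))
      where
      module T i = IsTotalOrder (IsLinearExtension.isTotalOrder (lin i))

    restrict : ∀ {d} → (Fin d → Rel (Fin n) 0ℓ) → Fin d → Rel Carrier 0ℓ
    restrict R i (x , _) (y , _) = R i x y

    hasRealizer? : ∀ d → Dec (HasRealizer (subposet P S) d)
    hasRealizer? d = map′ (λ (M , r) → restrict ⟦ M ⟧ᶠ , r) complete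
      (anySubset? (λ M → isRealizer? {L = restrict ⟦ M ⟧ᶠ} (λ _ _ _ → _ ∈? M)))
      where
      complete : HasRealizer (subposet P S) d → ∃[ M ] IsRealizer (restrict ⟦ M ⟧ᶠ)
      complete (L , r@(lin , _)) = encodeᶠ R? ,
        isRealizer-resp
          (λ { {i} {x , p} {y , q} l → encodeᶠ⁺ R? {i} {x} {y} (p , q , l) })
          (λ { {i} {x , p} {y , q} m → back (encodeᶠ⁻ R? {i} {x} {y} m) })
          r
        where
        module T i = IsTotalOrder (IsLinearExtension.isTotalOrder (lin i))

        L? : ∀ i → Decidable (L i)
        L? i = total∧dec⇒dec {_≈_ = _≈_}
          (λ {x} {y} → T.reflexive i {x} {y}) (T.antisym i) (T.total i)
          (λ x y → proj₁ x ≟ᶠ proj₁ y)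

        R : Fin d → Rel (Fin n) 0ℓ
        R i x y = Σ[ p ∈ x ∈ S ] Σ[ q ∈ y ∈ S ] L i (x , p) (y , q)

        back : ∀ {i x y p q} → R i x y → L i (x , p) (y , q)
        back {p = p} {q} (p′ , q′ , l)
          rewrite []=-irrelevant p p′ | []=-irrelevant q q′ = l

        R? : ∀ i → Decidable (R i)
        R? i x y with x ∈? S | y ∈? S
        ... | no x∉S | _ = no (λ (p , _) → x∉S p)
        ... | yes _ | no y∉S = no (λ (_ , q , _) → y∉S q)
        ... | yes p | yes q = map′ (λ l → p , q , l) back (L? i (x , p) (y , q))

  below? : {Q : Pred ℕ ℓ} → U.Decidable Q → ∀ b →
           (∃[ m ] IsLeast Q m × m ℕ.≤ b) ⊎ (∀ k → k ℕ.≤ b → ¬ Q k)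
  below? Q? zero with Q? 0
  ... | yes q = inj₁ (0 , (q , λ _ _ → z≤n) , z≤n)
  ... | no ¬q = inj₂ λ { zero _ → ¬q }
  below? {Q = Q} Q? (ℕ.suc b) with below? Q? b
  ... | inj₁ (m , l , m≤b) = inj₁ (m , l , ℕₚ.m≤n⇒m≤1+n m≤b)
  ... | inj₂ none with Q? (ℕ.suc b)
  ...   | yes q = inj₁ (ℕ.suc b , (q , λ k qk → ℕₚ.≰⇒> (λ k≤b → none k k≤b qk)) , ℕₚ.≤-refl)
  ...   | no ¬q = inj₂ λ k k≤1+b qk → Sum.[ (λ k<1+b → none k (ℕ.s≤s⁻¹ k<1+b) qk)
                                         , (λ { refl → ¬q qk }) ]
                                         (ℕₚ.m≤n⇒m<n∨m≡n k≤1+b)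

  greatest : {Q : Pred ℕ ℓ} → U.Decidable Q → Q 0 → ∀ b → (∀ k → Q k → k ℕ.≤ b) →
             ∃ (IsGreatest Q)
  greatest Q? q₀ zero bound = 0 , q₀ , bound
  greatest Q? q₀ (ℕ.suc b) bound with Q? (ℕ.suc b)
  ... | yes q = ℕ.suc b , q , bound
  ... | no ¬q = greatest Q? q₀ b λ k qk →
    Sum.[ ℕ.s≤s⁻¹ , (λ { refl → ⊥-elim (¬q qk) }) ] (ℕₚ.m≤n⇒m<n∨m≡n (bound k qk))

  dimensionAtMost? : ∀ {n} (P : FinPoset n) S k → Dec (DimensionAtMost (subposet P S) k)
  dimensionAtMost? P S k with below? (hasRealizer? P S) k
  ... | inj₁ found = yes found
  ... | inj₂ none  = no λ (d , (r , _) , d≤k) → none d d≤k r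

  fromMatrix : ∀ {n} (M : Subset (n ℕ.* n)) → IsPartialOrder _≡_ ⟦ M ⟧ → FinPoset n
  fromMatrix M po = record
    { _≤_ = ⟦ M ⟧
    ; isDecPartialOrder = record
      { isPartialOrder = po ; _≟_ = _≟ᶠ_ ; _≤?_ = λ _ _ → _ ∈? M }
    }

  HasRealizer-resp : ∀ {n} (P P′ : FinPoset n) →
    (FinPoset._≤_ P ⇒ FinPoset._≤_ P′) → (FinPoset._≤_ P′ ⇒ FinPoset._≤_ P) →
    ∀ S {d} → HasRealizer (subposet P S) d → HasRealizer (subposet P′ S) d
  HasRealizer-resp P P′ to from S (L , lin , int) = L ,
    (λ i → record
      { isTotalOrder = record
        { isPartialOrder = record
          { isPreorder = record
            { isEquivalence = Poset.isEquivalence (subposet P′ S)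
            ; reflexive     = λ {x} {y} → T.reflexive i {x} {y}
            ; trans         = T.trans i
            }
          ; antisym = T.antisym i
          }
        ; total = T.total i
        }
      ; extends = λ {x} {y} p → IsLinearExtension.extends (lin i) {x} {y} (from p)
      }) ,
    λ x y → mk⇔ (λ p → Equivalence.to (int x y) (from p))
                (λ p → to (Equivalence.from (int x y) p))
    where
    module T i = IsTotalOrder (IsLinearExtension.isTotalOrder (lin i))

  everyPosetHasSubposet? : ∀ n m → Dec (EveryPosetHasSubposet n m)
  everyPosetHasSubposet? n m = map′ fromMatrices (λ h M po → h (fromMatrix M po))
    (allSubsets? matrix?)
    where
    Good : Pred (FinPoset n) _
    Good P = Σ[ S ∈ Subset n ] ∣ S ∣ ≡ m × DimensionAtMost (subposet P S) 2

    matrix? : ∀ M → Dec ((po : IsPartialOrder _≡_ ⟦ M ⟧) → Good (fromMatrix M po))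
    matrix? M = guarded? (isPartialOrder? {_≤_ = ⟦ M ⟧} (λ _ _ → _ ∈? M)) transport
      (λ po → anySubset? λ S →
        (∣ S ∣ ℕₚ.≟ m) ×-dec dimensionAtMost? (fromMatrix M po) S 2)
      where
      transport : ∀ po po′ → Good (fromMatrix M po) → Good (fromMatrix M po′)
      transport po po′ (S , c , d , (r , least) , d≤2) =
        S , c , d ,
        (HasRealizer-resp (fromMatrix M po) (fromMatrix M po′) id id S r ,
         λ k rk → least k
           (HasRealizer-resp (fromMatrix M po′) (fromMatrix M po) id id S rk)) ,
        d≤2

    fromMatrices : (∀ M po → Good (fromMatrix M po)) → EveryPosetHasSubposet n m
    fromMatrices h P =
      let (S , c , d , (r , least) , d≤2) = h M po in
      S , c , d ,
      (HasRealizer-resp (fromMatrix M po) P out into S r ,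
       λ k rk → least k (HasRealizer-resp P (fromMatrix M po) into out S rk)) ,
      d≤2
      where
      module P = FinPoset P

      M : Subset (n ℕ.* n)
      M = encode P._≤?_

      into : P._≤_ ⇒ ⟦ M ⟧
      into = encode⁺ P._≤?_

      out : ⟦ M ⟧ ⇒ P._≤_
      out = encode⁻ P._≤?_

      po : IsPartialOrder _≡_ ⟦ M ⟧
      po = record
        { isPreorder = record
          { isEquivalence = isEquivalence
          ; reflexive     = λ e → into (P.reflexive e)
          ; trans         = λ p q → into (P.trans (out p) (out q))
          }
        ; antisym = λ p q → P.antisym (out p) (out q)
        }

  discrete : ∀ n → FinPoset n
  discrete n = record
    { _≤_ = _≡_
    ; isDecPartialOrder = record
      { isPartialOrder = record
        { isPreorder = record { isEquivalence = isEquivalence ; reflexive = id ; trans = trans }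
        ; antisym    = λ p _ → p
        }
      ; _≟_  = _≟ᶠ_
      ; _≤?_ = _≟ᶠ_
      }
    }

  largestExists : ∀ n → ∃ (IsGreatest (EveryPosetHasSubposet n))
  largestExists n = greatest (everyPosetHasSubposet? n) empty n
    (λ k h → let (S , c , _) = h (discrete n) in subst (ℕ._≤ n) c (∣p∣≤n S))
    where
    empty : EveryPosetHasSubposet n 0
    empty P = Subset.⊥ , ∣⊥∣≡0 n , 0 ,
      (((λ ()) , (λ ()) , λ x _ → ⊥-elim (∉⊥ (proj₂ x))) , λ _ _ → z≤n) , z≤n

abstract

  f : ℕ → ℕ
  f n = proj₁ (largestExists n)

  f-isGreatest : ∀ n → IsGreatest (EveryPosetHasSubposet n) (f n)
  f-isGreatest n = proj₂ (largestExists n)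

-- g(n) ≤ c n^(2/3) + o(n^(2/3)), that is: for every rational ε = p / q > 0,
-- eventually g(n) ≤ (c + ε) n^(2/3).  Both sides are nonnegative, so the
-- latter inequality, multiplied by q and cubed, is one between naturals.
_≤_·n^⅔+o[n^⅔] : (ℕ → ℕ) → ℕ → Set
g ≤ c ·n^⅔+o[n^⅔] = ∀ (p q : ℕ) .{{_ : NonZero p}} .{{_ : NonZero q}} →
  ∃[ N ] ∀ n → N ℕ.≤ n →
    (q ℕ.* g n) ℕ.^ 3 ℕ.≤ (q ℕ.* c ℕ.+ p) ℕ.^ 3 ℕ.* n ℕ.^ 2

{-# OPTIONS --safe #-}

-- Take n ≤ k³ points of [k]³, coordinates (a , b , c), ordered by the intersection
-- of the lexicographic orders of (a , c , −b), (b , a , −c) and (c , b , −a).  Every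
-- axis-parallel line is an antichain, but from any point a step down in direction
-- i and a step up in direction j lead to comparable points, for (i , j) = (2 , 1),
-- (2 , 3), (1 , 3).
--
-- If A and B realize a subposet S, then x ≺ y :⇔ A x y ∧ B y x orients all
-- incomparable pairs, and when y, z are comparable, x ≺ y forces x ≺ z.  Hence
-- if x is neither the top of its line in direction 3 nor the bottom of its line
-- in direction 2, it is a source or a sink of ≺ on its line in direction 1.  Each
-- such line has at most one source and one sink, so ∣ S ∣ ≤ k² + k² + 2k².
module Submission where

open import Defs

open import Level using (0ℓ; _⊔_)
open import Data.Empty using (⊥)
open import Data.Fin.Base as Fin using (Fin; zero; suc; toℕ; combine; remQuot; opposite; inject≤)
open import Data.Fin.Patterns using (0F; 1F; 2F; 3F)
import Data.Fin.Properties as Finₚ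
open import Data.Fin.Subset using (Subset; _∈_; ∣_∣; inside; outside)
open import Data.Fin.Subset.Properties using (_∈?_)
open import Data.Nat.Base as ℕ using (ℕ; NonZero; s≤s; z≤n; _+_; _*_; _^_)
import Data.Nat.Properties as ℕₚ
open import Data.Nat.Tactic.RingSolver using (solve-∀)
open import Data.Product using (∃; ∃-syntax; _×_; _,_; proj₁; proj₂)
open import Data.Product.Properties using (,-injective)
open import Data.Sum.Base using (_⊎_; inj₁; inj₂)
open import Data.Vec.Base using (_∷_; here; there)
open import Function.Base using (_∘_; flip)
open import Function.Bundles using (Equivalence)
open import Function.Definitions using (Injective)
open import Relation.Binary.Bundles using (Poset)
open import Relation.Binary.Core using (Rel; _⇒_)
open import Relation.Binary.Definitions using (tri<; tri≈; tri>; Trans; Transitive)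
open import Relation.Binary.PropositionalEquality
  using (_≡_; refl; sym; trans; cong; cong₂; subst; isEquivalence)
open import Relation.Binary.Structures using (IsTotalOrder)
open import Relation.Nullary using (¬_; Dec; yes; no; contradiction)
open import Relation.Nullary.Decidable using (_×-dec_)

-- Posets of dimension at most two

module _ {c ℓ₁ ℓ₂} (P : Poset c ℓ₁ ℓ₂) where
  open Poset P

  Comparable : Rel Carrier ℓ₂
  Comparable x y = x ≤ y ⊎ y ≤ x

  Incomparable : Rel Carrier ℓ₂
  Incomparable x y = ¬ Comparable x y

  -- The two extensions may coincide, so that dimensions 0, 1 and 2 are treated alike.
  record Realizes (A B : Rel Carrier ℓ₂) : Set (c ⊔ ℓ₁ ⊔ ℓ₂) where
    field
      linearˡ : IsLinearExtension P A
      linearʳ : IsLinearExtension P B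
      meet    : ∀ {x y} → A x y → B x y → x ≤ y

  realizes : DimensionAtMost P 2 → ∃[ A ] ∃[ B ] Realizes A B
  -- An empty realizer relates any two elements both ways, so `_≤_` is itself linear.
  realizes (0 , ((_ , _ , int) , _) , _) = _≤_ , _≤_ , record
    { linearˡ = linear ; linearʳ = linear ; meet = λ p _ → p }
    where
    linear : IsLinearExtension P _≤_
    linear = record
      { isTotalOrder = record
        { isPartialOrder = isPartialOrder
        ; total = λ x y → inj₁ (Equivalence.from (int x y) λ ())
        }
      ; extends = λ p → p
      }
  realizes (1 , ((L , lin , int) , _) , _) = L 0F , L 0F , record
    { linearˡ = lin 0F ; linearʳ = lin 0F
    ; meet = λ p _ → Equivalence.from (int _ _) λ { 0F → p }
    }
  realizes (2 , ((L , lin , int) , _) , _) = L 0F , L 1F , record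
    { linearˡ = lin 0F ; linearʳ = lin 1F
    ; meet = λ p q → Equivalence.from (int _ _) λ { 0F → p ; 1F → q }
    }
  realizes (ℕ.suc (ℕ.suc (ℕ.suc _)) , _ , s≤s (s≤s ()))

  Realizes-sym : ∀ {A B} → Realizes A B → Realizes B A
  Realizes-sym r = record { linearˡ = linearʳ ; linearʳ = linearˡ ; meet = flip meet }
    where open Realizes r

  module Conjugate {A B : Rel Carrier ℓ₂} (r : Realizes A B) where
    open Realizes r
    module Aₗ = IsLinearExtension linearˡ
    module Bₗ = IsLinearExtension linearʳ
    module Aₜ = IsTotalOrder Aₗ.isTotalOrder
    module Bₜ = IsTotalOrder Bₗ.isTotalOrder

    infix 4 _≺_
    _≺_ : Rel Carrier ℓ₂
    x ≺ y = A x y × B y x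

    orient : ∀ {x y} → Incomparable x y → x ≺ y ⊎ y ≺ x
    orient {x} {y} x∥y with Aₜ.total x y | Bₜ.total x y
    ... | inj₁ a | inj₁ b = contradiction (inj₁ (meet a b)) x∥y
    ... | inj₁ a | inj₂ b = inj₁ (a , b)
    ... | inj₂ a | inj₁ b = inj₂ (a , b)
    ... | inj₂ a | inj₂ b = contradiction (inj₂ (meet a b)) x∥y

    ≺-asym : ∀ {x y} → Incomparable x y → x ≺ y → ¬ y ≺ x
    ≺-asym x∥y (a , _) (a′ , _) = x∥y (inj₁ (reflexive (Aₜ.antisym a a′)))

    -- Gallai's forcing relation. If instead `z ≺ x`, then `A` (when `y ≤ z`) or `B` (when `z ≤ y`)
    -- has a cycle through `x`, `y`, `z`, which gives `x ≈ z`.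
    ≺-forced : ∀ {x y z} → Incomparable x z → Comparable y z → x ≺ y → x ≺ z
    ≺-forced x∥z (inj₁ y≤z) (a , b) with orient x∥z
    ... | inj₁ x≺z      = x≺z
    ... | inj₂ (a′ , _) =
      contradiction (inj₁ (reflexive (Aₜ.antisym (Aₜ.trans a (Aₗ.extends y≤z)) a′))) x∥z
    ≺-forced x∥z (inj₂ z≤y) (a , b) with orient x∥z
    ... | inj₁ x≺z      = x≺z
    ... | inj₂ (_ , b′) =
      contradiction (inj₁ (reflexive (Bₜ.antisym b′ (Bₜ.trans (Bₗ.extends z≤y) b)))) x∥z

  Comparable-sym : ∀ {x y} → Comparable x y → Comparable y x
  Comparable-sym (inj₁ p) = inj₂ p
  Comparable-sym (inj₂ p) = inj₁ p

  -- Rᵢ x y stands for: y lies above x on the same line in direction i.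
  module _ {ℓ} {R₁ R₂ R₃ : Rel Carrier ℓ}
    (R₁-trans : Transitive R₁)
    (∥₁ : R₁ ⇒ Incomparable) (∥₂ : R₂ ⇒ Incomparable) (∥₃ : R₃ ⇒ Incomparable)
    (R₂R₁ : Trans R₂ R₁ Comparable)
    (R₂R₃ : Trans R₂ R₃ Comparable)
    (R₁R₃ : Trans R₁ R₃ Comparable)
    where

    private
      -- Either `x′` would be neither a source nor a sink, or `x` and `x″` would both be sources.
      no-source-triple : ∀ {A B} (r : Realizes A B) {x x′ x″ d d′ u′ u″} →
        R₁ x x′ → R₁ x′ x″ → R₂ d x → R₂ d′ x′ → R₃ x′ u′ → R₃ x″ u″ →
        ¬ Conjugate._≺_ r x x′
      no-source-triple r p p′ dx dx′ xu′ xu″ x≺x′ with Conjugate.orient r (∥₁ p′)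
      -- Forcing passes along the comparable pairs `x″ , d′`, then `d′ , u′`, then `u′ , x`, and
      -- turns `x′ ≺ x″` into `x′ ≺ x`.
      ... | inj₁ x′≺x″ = ≺-asym (∥₁ p) x≺x′
            (≺-forced (∥₁ p ∘ Comparable-sym) (Comparable-sym (R₁R₃ p xu′))
              (≺-forced (∥₃ xu′) (R₂R₃ dx′ xu′)
                (≺-forced (∥₂ dx′ ∘ Comparable-sym) (Comparable-sym (R₂R₁ dx′ p′)) x′≺x″)))
        where open Conjugate r
      -- Through `d`, `x ≺ x′` forces `x ≺ x″`; through `u″`, `x″ ≺ x′` forces `x″ ≺ x`.
      ... | inj₂ x″≺x′ = ≺-asym (∥₁ (R₁-trans p p′))
            (≺-forced (∥₁ (R₁-trans p p′)) (R₂R₁ dx (R₁-trans p p′))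
              (≺-forced (∥₂ dx ∘ Comparable-sym) (Comparable-sym (R₂R₁ dx p)) x≺x′))
            (≺-forced (∥₁ (R₁-trans p p′) ∘ Comparable-sym)
              (Comparable-sym (R₁R₃ (R₁-trans p p′) xu″))
              (≺-forced (∥₃ xu″) (R₁R₃ p′ xu″) x″≺x′))
        where open Conjugate r

    -- Swapping A and B reverses ≺, so we may assume x ≺ x′.
    no-triple : DimensionAtMost P 2 → ∀ {x x′ x″ d d′ u′ u″} →
      R₁ x x′ → R₁ x′ x″ → R₂ d x → R₂ d′ x′ → R₃ x′ u′ → R₃ x″ u″ → ⊥
    no-triple dim p p′ dx dx′ xu′ xu″ with _ , _ , r ← realizes dim with Conjugate.orient r (∥₁ p)
    ... | inj₁ x≺x′      = no-source-triple r p p′ dx dx′ xu′ xu″ x≺x′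
    ... | inj₂ (a′ , b′) = no-source-triple (Realizes-sym r) p p′ dx dx′ xu′ xu″ (b′ , a′)

-- The grid poset

opposite-antimono-< : ∀ {k} {i j : Fin k} → i Fin.< j → opposite j Fin.< opposite i
opposite-antimono-< {k} {i} {j} i<j
  rewrite Finₚ.opposite-prop i | Finₚ.opposite-prop j =
  ℕₚ.∸-monoʳ-< (s≤s i<j) (Finₚ.toℕ<n j)

combine-monoʳ-< : ∀ {m n} (i : Fin m) {j l : Fin n} → j Fin.< l → combine i j Fin.< combine i l
combine-monoʳ-< {m} {n} i {j} {l} j<l
  rewrite Finₚ.toℕ-combine i j | Finₚ.toℕ-combine i l = ℕₚ.+-monoʳ-< (n * toℕ i) j<l

module Key {n k} (a b c : Fin n → Fin k) where

  -- `combine` numbers pairs lexicographically and `opposite` reverses a coordinate, so comparing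
  -- keys is comparing `(a , b , −c)` lexicographically, and the order laws come from the naturals.
  key : Fin n → Fin (k * (k * k))
  key x = combine (a x) (combine (b x) (opposite (c x)))

  key-<₁ : ∀ x y → a x Fin.< a y → key x Fin.< key y
  key-<₁ _ _ = Finₚ.combine-monoˡ-< _ _

  key-<₂ : ∀ x y → a x ≡ a y → b x Fin.< b y → key x Fin.< key y
  key-<₂ x y a≡ b< rewrite a≡ = combine-monoʳ-< (a y) (Finₚ.combine-monoˡ-< _ _ b<)

  key-<₃ : ∀ x y → a x ≡ a y → b x ≡ b y → c y Fin.< c x → key x Fin.< key y
  key-<₃ x y a≡ b≡ c> rewrite a≡ | b≡ =
    combine-monoʳ-< (a y) (combine-monoʳ-< (b y) (opposite-antimono-< c>))

  key-injective : ∀ x y → key x ≡ key y → a x ≡ a y × b x ≡ b y × c x ≡ c y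
  key-injective x y eq
    with a≡ , eq′ ← Finₚ.combine-injective (a x) _ (a y) _ eq
    with b≡ , oc≡ ← Finₚ.combine-injective (b x) _ (b y) _ eq′
    = a≡ , b≡ ,
      trans (sym (Finₚ.opposite-involutive (c x)))
        (trans (cong opposite oc≡) (Finₚ.opposite-involutive (c y)))

-- Enumerating `S` by `Fin ∣ S ∣` and applying `φ` is injective. `φ` may use the membership proof,
-- as `slot` does below.
∣S∣≤ : ∀ {n m} (S : Subset n) (φ : ∀ {x} → x ∈ S → Fin m) →
  (∀ {x y} (p : x ∈ S) (q : y ∈ S) → φ p ≡ φ q → x ≡ y) → ∣ S ∣ ℕ.≤ m
∣S∣≤ S φ φ-inj = Finₚ.injective⇒≤ {f = φ ∘ element∈ S} (element-injective S ∘ φ-inj _ _)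
  where
  element : ∀ {n} (S : Subset n) → Fin ∣ S ∣ → Fin n
  element (outside ∷ S) i       = suc (element S i)
  element (inside  ∷ S) zero    = zero
  element (inside  ∷ S) (suc i) = suc (element S i)

  element∈ : ∀ {n} (S : Subset n) i → element S i ∈ S
  element∈ (outside ∷ S) i       = there (element∈ S i)
  element∈ (inside  ∷ S) zero    = here
  element∈ (inside  ∷ S) (suc i) = there (element∈ S i)

  element-injective : ∀ {n} (S : Subset n) → Injective _≡_ _≡_ (element S)
  element-injective (outside ∷ S) eq = element-injective S (Finₚ.suc-injective eq)
  element-injective (inside  ∷ S) {zero}  {zero}  eq = refl
  element-injective (inside  ∷ S) {suc i} {suc j} eq =
    cong suc (element-injective S (Finₚ.suc-injective eq))

module Grid {n k} (a b c : Fin n → Fin k)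
  (coordinates-injective : ∀ {x y} → a x ≡ a y → b x ≡ b y → c x ≡ c y → x ≡ y)
  where

  module K₁ = Key a c b
  module K₂ = Key b a c
  module K₃ = Key c b a

  infix 4 _≼_
  _≼_ : Rel (Fin n) 0ℓ
  x ≼ y = K₁.key x Fin.≤ K₁.key y × K₂.key x Fin.≤ K₂.key y × K₃.key x Fin.≤ K₃.key y

  gridPoset : FinPoset n
  gridPoset = record
    { _≤_ = _≼_
    ; isDecPartialOrder = record
      { isPartialOrder = record
        { isPreorder = record
          { isEquivalence = isEquivalence
          ; reflexive     = λ { refl → ℕₚ.≤-refl , ℕₚ.≤-refl , ℕₚ.≤-refl }
          ; trans         = λ (p₁ , p₂ , p₃) (q₁ , q₂ , q₃) →
              ℕₚ.≤-trans p₁ q₁ , ℕₚ.≤-trans p₂ q₂ , ℕₚ.≤-trans p₃ q₃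
          }
        ; antisym = λ {x} {y} (p , _) (q , _) →
            let (a≡ , c≡ , b≡) = K₁.key-injective x y (Finₚ.≤-antisym p q) in
            coordinates-injective a≡ b≡ c≡
        }
      ; _≟_  = Finₚ._≟_
      ; _≤?_ = λ x y → (K₁.key x Finₚ.≤? K₁.key y) ×-dec (K₂.key x Finₚ.≤? K₂.key y)
                 ×-dec (K₃.key x Finₚ.≤? K₃.key y)
      }
    }

  infix 4 _<₁_ _<₂_ _<₃_ _<₁?_ _<₂?_ _<₃?_
  _<₁_ _<₂_ _<₃_ : Rel (Fin n) 0ℓ
  x <₁ y = a x Fin.< a y × b x ≡ b y × c x ≡ c y
  x <₂ y = b x Fin.< b y × a x ≡ a y × c x ≡ c y
  x <₃ y = c x Fin.< c y × a x ≡ a y × b x ≡ b y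

  _<₁?_ : ∀ x y → Dec (x <₁ y)
  x <₁? y = (a x Finₚ.<? a y) ×-dec (b x Finₚ.≟ b y) ×-dec (c x Finₚ.≟ c y)

  _<₂?_ : ∀ x y → Dec (x <₂ y)
  x <₂? y = (b x Finₚ.<? b y) ×-dec (a x Finₚ.≟ a y) ×-dec (c x Finₚ.≟ c y)

  _<₃?_ : ∀ x y → Dec (x <₃ y)
  x <₃? y = (c x Finₚ.<? c y) ×-dec (a x Finₚ.≟ a y) ×-dec (b x Finₚ.≟ b y)

  cmp₁ : ∀ {x y} → b x ≡ b y → c x ≡ c y → ¬ x <₁ y → ¬ y <₁ x → x ≡ y
  cmp₁ {x} {y} b≡ c≡ x≮y y≮x with Finₚ.<-cmp (a x) (a y)
  ... | tri< a< _ _ = contradiction (a< , b≡ , c≡) x≮y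
  ... | tri≈ _ a≡ _ = coordinates-injective a≡ b≡ c≡
  ... | tri> _ _ a> = contradiction (a> , sym b≡ , sym c≡) y≮x

  cmp₂ : ∀ {x y} → a x ≡ a y → c x ≡ c y → ¬ x <₂ y → ¬ y <₂ x → x ≡ y
  cmp₂ {x} {y} a≡ c≡ x≮y y≮x with Finₚ.<-cmp (b x) (b y)
  ... | tri< b< _ _ = contradiction (b< , a≡ , c≡) x≮y
  ... | tri≈ _ b≡ _ = coordinates-injective a≡ b≡ c≡
  ... | tri> _ _ b> = contradiction (b> , sym a≡ , sym c≡) y≮x

  cmp₃ : ∀ {x y} → a x ≡ a y → b x ≡ b y → ¬ x <₃ y → ¬ y <₃ x → x ≡ y
  cmp₃ {x} {y} a≡ b≡ x≮y y≮x with Finₚ.<-cmp (c x) (c y)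
  ... | tri< c< _ _ = contradiction (c< , a≡ , b≡) x≮y
  ... | tri≈ _ c≡ _ = coordinates-injective a≡ b≡ c≡
  ... | tri> _ _ c> = contradiction (c> , sym a≡ , sym b≡) y≮x

  <₁-trans : Transitive _<₁_
  <₁-trans (p , q , r) (p′ , q′ , r′) = ℕₚ.<-trans p p′ , trans q q′ , trans r r′

  _∥_ _∼_ : Rel (Fin n) 0ℓ
  _∥_ = Incomparable (FinPoset.poset gridPoset)
  _∼_ = Comparable (FinPoset.poset gridPoset)

  -- Each coordinate leads one key and stands last, reversed, in another: raising `a` alone raises
  -- `K₁` and lowers `K₃`. Likewise `b` with `K₂` and `K₁`, and `c` with `K₃` and `K₂`.
  <₁⇒∥ : _<₁_ ⇒ _∥_
  <₁⇒∥ {x} {y} (a< , b≡ , c≡) (inj₁ (_ , _ , p)) = ℕₚ.<⇒≱ (K₃.key-<₃ y x (sym c≡) (sym b≡) a<) p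
  <₁⇒∥ {x} {y} (a< , b≡ , c≡) (inj₂ (p , _ , _)) = ℕₚ.<⇒≱ (K₁.key-<₁ x y a<) p

  <₂⇒∥ : _<₂_ ⇒ _∥_
  <₂⇒∥ {x} {y} (b< , a≡ , c≡) (inj₁ (p , _ , _)) = ℕₚ.<⇒≱ (K₁.key-<₃ y x (sym a≡) (sym c≡) b<) p
  <₂⇒∥ {x} {y} (b< , a≡ , c≡) (inj₂ (_ , p , _)) = ℕₚ.<⇒≱ (K₂.key-<₁ x y b<) p

  <₃⇒∥ : _<₃_ ⇒ _∥_
  <₃⇒∥ {x} {y} (c< , a≡ , b≡) (inj₁ (_ , p , _)) = ℕₚ.<⇒≱ (K₂.key-<₃ y x (sym b≡) (sym a≡) c<) p
  <₃⇒∥ {x} {y} (c< , a≡ , b≡) (inj₂ (_ , _ , p)) = ℕₚ.<⇒≱ (K₃.key-<₁ x y c<) p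

  -- Here and in the next two lemmas, two coordinates rise and one is fixed. Two keys begin with a
  -- rising coordinate; in the third the fixed one ties and the next rises before the reversed one
  -- counts.
  <₂<₁⇒∼ : Trans _<₂_ _<₁_ _∼_
  <₂<₁⇒∼ {x} {_} {z} (b< , a≡ , c≡) (a< , b≡ , c≡′) = inj₁
    ( ℕₚ.<⇒≤ (K₁.key-<₁ x z (subst (Fin._< a z) (sym a≡) a<))
    , ℕₚ.<⇒≤ (K₂.key-<₁ x z b<′)
    , ℕₚ.<⇒≤ (K₃.key-<₂ x z (trans c≡ c≡′) b<′))
    where b<′ = subst (b x Fin.<_) b≡ b<

  <₂<₃⇒∼ : Trans _<₂_ _<₃_ _∼_
  <₂<₃⇒∼ {x} {_} {z} (b< , a≡ , c≡) (c< , a≡′ , b≡) = inj₁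
    ( ℕₚ.<⇒≤ (K₁.key-<₂ x z (trans a≡ a≡′) c<′)
    , ℕₚ.<⇒≤ (K₂.key-<₁ x z (subst (b x Fin.<_) b≡ b<))
    , ℕₚ.<⇒≤ (K₃.key-<₁ x z c<′))
    where c<′ = subst (Fin._< c z) (sym c≡) c<

  <₁<₃⇒∼ : Trans _<₁_ _<₃_ _∼_
  <₁<₃⇒∼ {x} {_} {z} (a< , b≡ , c≡) (c< , a≡ , b≡′) = inj₁
    ( ℕₚ.<⇒≤ (K₁.key-<₁ x z a<′)
    , ℕₚ.<⇒≤ (K₂.key-<₂ x z (trans b≡ b≡′) a<′)
    , ℕₚ.<⇒≤ (K₃.key-<₁ x z (subst (Fin._< c z) (sym c≡) c<)))
    where a<′ = subst (a x Fin.<_) a≡ a<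

  -- Counting a subposet of dimension at most two

  module _ (S : Subset n) (dim : DimensionAtMost (subposet gridPoset S) 2) where

    HasAbove₃ HasBelow₂ Inner HasInnerBelow₁ : Fin n → Set
    HasAbove₃ x = ∃[ u ] u ∈ S × x <₃ u
    HasBelow₂ x = ∃[ d ] d ∈ S × d <₂ x
    Inner x = x ∈ S × HasAbove₃ x × HasBelow₂ x
    HasInnerBelow₁ x = ∃[ y ] Inner y × y <₁ x

    hasAbove₃? : ∀ x → Dec (HasAbove₃ x)
    hasAbove₃? x = Finₚ.any? λ u → (u ∈? S) ×-dec (x <₃? u)

    hasBelow₂? : ∀ x → Dec (HasBelow₂ x)
    hasBelow₂? x = Finₚ.any? λ d → (d ∈? S) ×-dec (d <₂? x)

    hasInnerBelow₁? : ∀ x → Dec (HasInnerBelow₁ x)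
    hasInnerBelow₁? x = Finₚ.any? λ y →
      ((y ∈? S) ×-dec hasAbove₃? y ×-dec hasBelow₂? y) ×-dec (y <₁? x)

    -- Limits a line in direction 1 to two inner points, which `first₁` and `second₁` will count.
    no-inner-triple : ∀ {x x′ x″} → Inner x → Inner x′ → Inner x″ → x <₁ x′ → ¬ x′ <₁ x″
    no-inner-triple (x∈ , _ , d , d∈ , d<x) (x′∈ , (u′ , u′∈ , x′<u′) , d′ , d′∈ , d′<x′)
      (x″∈ , (u″ , u″∈ , x″<u″) , _) x<x′ x′<x″ =
      -- The subposet compares first components in the grid, so the grid lemmas apply as they are.
      no-triple (subposet gridPoset S)
        {R₁ = λ x y → proj₁ x <₁ proj₁ y} {λ x y → proj₁ x <₂ proj₁ y} {λ x y → proj₁ x <₃ proj₁ y}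
        <₁-trans <₁⇒∥ <₂⇒∥ <₃⇒∥ <₂<₁⇒∼ <₂<₃⇒∼ <₁<₃⇒∼ dim
        {_ , x∈} {_ , x′∈} {_ , x″∈} {_ , d∈} {_ , d′∈} {_ , u′∈} {_ , u″∈}
        x<x′ x′<x″ d<x d′<x′ x′<u′ x″<u″

    -- The pair names a line by its fixed coordinates. They enter through equations so that matching
    -- two slots with the same index unifies variables only.
    data Slot (x : Fin n) : Fin 4 × Fin k × Fin k → Set where
      top₃    : ¬ HasAbove₃ x → ∀ {i j} → a x ≡ i → b x ≡ j → Slot x (0F , i , j)
      bottom₂ : ¬ HasBelow₂ x → ∀ {i j} → a x ≡ i → c x ≡ j → Slot x (1F , i , j)
      first₁  : Inner x → ¬ HasInnerBelow₁ x → ∀ {i j} → b x ≡ i → c x ≡ j → Slot x (2F , i , j)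
      second₁ : Inner x → HasInnerBelow₁ x → ∀ {i j} → b x ≡ i → c x ≡ j → Slot x (3F , i , j)

    slot : ∀ {x} → x ∈ S → ∃ (Slot x)
    slot {x} x∈ with hasAbove₃? x | hasBelow₂? x | hasInnerBelow₁? x
    ... | no ¬u | _     | _     = _ , top₃ ¬u refl refl
    ... | yes _ | no ¬d | _     = _ , bottom₂ ¬d refl refl
    ... | yes u | yes d | no ¬y = _ , first₁ (x∈ , u , d) ¬y refl refl
    ... | yes u | yes d | yes y = _ , second₁ (x∈ , u , d) y refl refl

    -- Distinct points with the same slot would be ordered along their common line, and one of them
    -- would violate its defining condition.
    slot-unique : ∀ {x y s} → x ∈ S → y ∈ S → Slot x s → Slot y s → x ≡ y
    slot-unique x∈ y∈ (top₃ ¬u p q) (top₃ ¬u′ p′ q′) =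
      cmp₃ (trans p (sym p′)) (trans q (sym q′)) (λ x<y → ¬u (_ , y∈ , x<y)) (λ y<x → ¬u′ (_ , x∈ , y<x))
    slot-unique x∈ y∈ (bottom₂ ¬d p q) (bottom₂ ¬d′ p′ q′) =
      cmp₂ (trans p (sym p′)) (trans q (sym q′)) (λ x<y → ¬d′ (_ , x∈ , x<y)) (λ y<x → ¬d (_ , y∈ , y<x))
    slot-unique _ _ (first₁ x ¬y p q) (first₁ x′ ¬y′ p′ q′) =
      cmp₁ (trans p (sym p′)) (trans q (sym q′)) (λ x<y → ¬y′ (_ , x , x<y)) (λ y<x → ¬y (_ , x′ , y<x))
    -- Two such points and the inner point below the lower one would form a triple.
    slot-unique _ _ (second₁ x (_ , z , z<x) p q) (second₁ x′ (_ , z′ , z′<y) p′ q′) =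
      cmp₁ (trans p (sym p′)) (trans q (sym q′)) (no-inner-triple z x x′ z<x) (no-inner-triple z′ x′ x z′<y)

    size-bound : ∣ S ∣ ℕ.≤ 4 * (k * k)
    size-bound = ∣S∣≤ S (encode ∘ proj₁ ∘ slot) λ p q eq →
      slot-unique p q (proj₂ (slot p))
        (subst (Slot _) (sym (encode-injective (proj₁ (slot p)) (proj₁ (slot q)) eq)) (proj₂ (slot q)))
      where
      encode : Fin 4 × Fin k × Fin k → Fin (4 * (k * k))
      encode (s , i , j) = combine s (combine i j)

      encode-injective : ∀ s t → encode s ≡ encode t → s ≡ t
      encode-injective (s , i , j) (s′ , i′ , j′) eq
        with s≡ , eq′ ← Finₚ.combine-injective s _ s′ _ eq
        with i≡ , j≡ ← Finₚ.combine-injective i j i′ j′ eq′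
        = cong₂ _,_ s≡ (cong₂ _,_ i≡ j≡)

-- Every poset on `n` elements has a subposet of size `f n` and dimension at most 2; this is applied
-- to `n` cells of the cube, whose coordinates are base-`k` digits.
f≤4k² : ∀ {n} k → n ℕ.≤ k * (k * k) → f n ℕ.≤ 4 * (k * k)
f≤4k² {n} k n≤k³ =
  let (S , ∣S∣≡f , dim) = proj₁ (f-isGreatest n) gridPoset in
  subst (ℕ._≤ _) ∣S∣≡f (size-bound S dim)
  where
  split : Fin n → Fin k × Fin (k * k)
  split x = remQuot (k * k) (inject≤ x n≤k³)

  a b c : Fin n → Fin k
  a x = proj₁ (split x)
  b x = proj₁ (remQuot {k} k (proj₂ (split x)))
  c x = proj₂ (remQuot {k} k (proj₂ (split x)))

  remQuot-injective : ∀ {m} l (x y : Fin (m * l)) → remQuot {m} l x ≡ remQuot l y → x ≡ y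
  remQuot-injective {m} l x y eq with p , q ← ,-injective eq =
    trans (sym (Finₚ.combine-remQuot {m} l x)) (trans (cong₂ combine p q) (Finₚ.combine-remQuot {m} l y))

  coordinates-injective : ∀ {x y} → a x ≡ a y → b x ≡ b y → c x ≡ c y → x ≡ y
  coordinates-injective {x} {y} a≡ b≡ c≡ = Finₚ.inject≤-injective n≤k³ n≤k³ x y
    (remQuot-injective {k} (k * k) _ _
      (cong₂ _,_ a≡ (remQuot-injective {k} k _ _ (cong₂ _,_ b≡ c≡))))
  open Grid a b c coordinates-injective using (gridPoset; size-bound)

-- Asymptotics

∛-floor : ∀ n → ∃[ m ] m ^ 3 ℕ.≤ n × n ℕ.< ℕ.suc m ^ 3
∛-floor 0 = 0 , z≤n , s≤s z≤n
∛-floor (ℕ.suc n) with ∛-floor n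
... | m , m³≤n , n<m′³ with ℕ.suc n ℕₚ.<? ℕ.suc m ^ 3
...   | yes n′<m′³ = m , ℕₚ.m≤n⇒m≤1+n m³≤n , n′<m′³
...   | no  n′≮m′³ = ℕ.suc m , ℕₚ.≮⇒≥ n′≮m′³ ,
        ℕₚ.≤-<-trans n<m′³ (ℕₚ.^-monoˡ-< 3 (ℕₚ.n<1+n (ℕ.suc m)))

-- The excess over `4 * q * m²` is `4 * q * (2 * m + 1)`. As `m` is positive, this is at most
-- `12 * q * m`, hence at most `m²`, which `p ≥ 1` absorbs.
quadratic-bound : ∀ p q m .{{_ : NonZero p}} .{{_ : NonZero q}} → 12 * q ℕ.≤ m →
  q * (4 * (ℕ.suc m * ℕ.suc m)) ℕ.≤ (q * 4 + p) * (m * m)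
quadratic-bound p q 0 12q≤0 = contradiction (ℕₚ.≤-trans (ℕₚ.m≤n*m q 12) 12q≤0) (ℕₚ.<⇒≱ (ℕ.>-nonZero⁻¹ q))
quadratic-bound p q m@(ℕ.suc l) 12q≤m = begin
  q * (4 * (ℕ.suc m * ℕ.suc m))         ≡⟨ expand q m ⟩
  q * 4 * (m * m) + 4 * q * (2 * m + 1) ≤⟨ ℕₚ.+-monoʳ-≤ _ (ℕₚ.*-monoʳ-≤ (4 * q) (ℕₚ.+-monoʳ-≤ (2 * m) (s≤s z≤n))) ⟩
  q * 4 * (m * m) + 4 * q * (2 * m + m) ≡⟨ regroup q m ⟩
  q * 4 * (m * m) + 12 * q * m          ≤⟨ ℕₚ.+-monoʳ-≤ _ (ℕₚ.*-monoˡ-≤ m 12q≤m) ⟩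
  q * 4 * (m * m) + m * m               ≤⟨ ℕₚ.+-monoʳ-≤ _ (ℕₚ.m≤n*m (m * m) p) ⟩
  q * 4 * (m * m) + p * (m * m)         ≡⟨ ℕₚ.*-distribʳ-+ (m * m) (q * 4) p ⟨
  (q * 4 + p) * (m * m)                 ∎
  where
  open ℕₚ.≤-Reasoning

  expand : ∀ q m → q * (4 * ((1 + m) * (1 + m))) ≡ q * 4 * (m * m) + 4 * q * (2 * m + 1)
  expand = solve-∀

  regroup : ∀ q m → q * 4 * (m * m) + 4 * q * (2 * m + m) ≡ q * 4 * (m * m) + 12 * q * m
  regroup = solve-∀

theorem1 : f ≤ 4 ·n^⅔+o[n^⅔]
-- From this threshold on, the integer cube root `m` of `n` is at least `12 * q`, while a cube of
-- side `suc m` holds `n` points.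
theorem1 p q = (12 * q) ^ 3 , bound
  where
  cube-product : ∀ x m →
    x * (m * m) * (x * (m * m) * (x * (m * m) * 1)) ≡
    x * (x * (x * 1)) * (m * (m * (m * 1)) * (m * (m * (m * 1)) * 1))
  cube-product = solve-∀

  bound : ∀ n → (12 * q) ^ 3 ℕ.≤ n → (q * f n) ^ 3 ℕ.≤ (q * 4 + p) ^ 3 * n ^ 2
  bound n N≤n with m , m³≤n , n<m′³ ← ∛-floor n = begin
    (q * f n) ^ 3                       ≤⟨ ℕₚ.^-monoˡ-≤ 3 (ℕₚ.*-monoʳ-≤ q (f≤4k² (ℕ.suc m) n≤m′³)) ⟩
    (q * (4 * (ℕ.suc m * ℕ.suc m))) ^ 3 ≤⟨ ℕₚ.^-monoˡ-≤ 3 (quadratic-bound p q m 12q≤m) ⟩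
    ((q * 4 + p) * (m * m)) ^ 3         ≡⟨ cube-product (q * 4 + p) m ⟩
    (q * 4 + p) ^ 3 * (m ^ 3) ^ 2       ≤⟨ ℕₚ.*-monoʳ-≤ ((q * 4 + p) ^ 3) (ℕₚ.^-monoˡ-≤ 2 m³≤n) ⟩
    (q * 4 + p) ^ 3 * n ^ 2             ∎
    where
    open ℕₚ.≤-Reasoning

    n≤m′³ : n ℕ.≤ ℕ.suc m * (ℕ.suc m * ℕ.suc m)
    n≤m′³ = subst (λ z → n ℕ.≤ ℕ.suc m * (ℕ.suc m * z)) (ℕₚ.*-identityʳ (ℕ.suc m)) (ℕₚ.<⇒≤ n<m′³)

    12q≤m : 12 * q ℕ.≤ m
    12q≤m = ℕ.s≤s⁻¹ (ℕₚ.≰⇒> λ m′≤12q →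
      ℕₚ.<⇒≱ n<m′³ (ℕₚ.≤-trans (ℕₚ.^-monoˡ-≤ 3 m′≤12q) N≤n))
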